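{- Let $G$ be a connected graph of order $n$ and let $k$ be an integer with $2\leq k\leq n$. Then $$\lambda_k(G)\geq (k-1)\,\kappa'_k(G).$$ Moreover, the bound is sharp: for each $k\geq 2$, equality holds for some connected graph.
   Context: Graphs are finite, simple and undirected; the order of a graph is its number of vertices. $k$-edge-connectivity: for a graph $G$ of order $n$ and $2\leq k\leq n$, $\lambda_k(G)$ is the smallest number of edges whose removal from $G$ produces a graph with at least $k$ connected components. Generalized $k$-connectivity: for $S\subseteq V(G)$ with $|S|\geq 2$, an $S$-tree is a subgraph $T$ of $G$ that is a tree with $S\subseteq V(T)$. Two $S$-trees $T_1,T_2$ are internally disjoint if $E(T_1)\cap E(T_2)=\emptyset$ and $V(T_1)\cap V(T_2)=S$. Let $\kappa'_G(S)$ be the maximum number of pairwise internally disjoint $S$-trees in $G$. For $2\leq k\leq n$, $\kappa'_k(G)=\min\{\kappa'_G(S)\mid S\subseteq V(G),\ |S|=k\}$. -}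

module Defs where

import Data.Bool.Properties as Bool
open import Data.Fin using (Fin; zero; suc; inject≤)
import Data.Fin as Fin
import Data.Fin.Properties as Fin
open import Data.Fin.Subset
  using (Subset; inside; outside; _∈_; _∉_; _⊆_; _∩_; _∪_; ∁; ⁅_⁆; ⊤; ⊥; ∣_∣; Nonempty)
open import Data.Fin.Subset.Properties
open import Data.List using (List; length; filter; allFin; cartesianProduct)
import Data.List as List
open import Data.Nat using (ℕ; zero; suc; _+_; _≤_; _<_; z≤n; s≤s)
open import Data.Nat.Induction using (Acc; acc; <-wellFounded)
import Data.Nat.Properties as ℕ
open import Data.Product using (Σ; ∃; _×_; _,_; proj₁; proj₂)
import Data.Product.Properties as Product
open import Data.Sum using (_⊎_; inj₁; inj₂; [_,_]′)
open import Data.Vec using (Vec; []; _∷_; head; last; lookup; tabulate)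
import Data.Vec.Properties as Vec
open import Data.Vec.Relation.Unary.All as All using (All; []; _∷_)
import Data.Vec.Relation.Unary.All.Properties as All
open import Data.Vec.Relation.Unary.AllPairs using (AllPairs; []; _∷_; allPairs?)
open import Data.Vec.Relation.Unary.Linked using (Linked; linked?)
open import Data.Vec.Relation.Unary.Unique.Propositional using (Unique)
import Data.Vec.Relation.Unary.Unique.Propositional.Properties as Unique
open import Function using (_∘_; _⇔_; mk⇔; Equivalence)
open import Level using (0ℓ)
open import Relation.Binary using (Rel; Symmetric; Irreflexive)
import Relation.Binary as B
open import Relation.Binary.Construct.Closure.ReflexiveTransitive using (Star; ε; _◅_; _◅◅_)
open import Relation.Binary.PropositionalEquality
open import Relation.Nullary using (¬_; Dec; yes; no; ¬?; contradiction)
open import Relation.Nullary.Decidable using (map′; _×-dec_; _⊎-dec_; _→-dec_)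
open import Relation.Unary using (Pred; Decidable)

private
  variable
    m n k : ℕ

IsLeast : Pred ℕ 0ℓ → ℕ → Set
IsLeast P l = P l × (∀ j → P j → l ≤ j)

IsGreatest : Pred ℕ 0ℓ → ℕ → Set
IsGreatest P g = P g × (∀ j → P j → j ≤ g)

abstract
  least : {P : Pred ℕ 0ℓ} → Decidable P → ∃ P → ∃ (IsLeast P)
  least {P} P? (i , Pi) = go i Pi (<-wellFounded i)
    where
    go : ∀ i → P i → Acc _<_ i → ∃ (IsLeast P)
    go i Pi (acc rec) with ℕ.anyUpTo? P? i
    ... | yes (j , j<i , Pj) = go j Pj (rec j<i)
    ... | no ¬below = i , Pi , λ j Pj → ℕ.≮⇒≥ λ j<i → ¬below (j , j<i , Pj)

  greatest : {P : Pred ℕ 0ℓ} → Decidable P → P 0 →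
             ∀ b → (∀ j → P j → j ≤ b) → ∃ (IsGreatest P)
  greatest P? P0 zero    bound = 0 , P0 , bound
  greatest P? P0 (suc b) bound with P? (suc b)
  ... | yes Pb = suc b , Pb , bound
  ... | no ¬Pb = greatest P? P0 b λ j Pj →
    ℕ.≤-pred (ℕ.≤∧≢⇒< (bound j Pj) λ { refl → ¬Pb Pj })

record Graph (n : ℕ) : Set₁ where
  field
    _~_      : Rel (Fin n) 0ℓ
    ~-sym    : Symmetric _~_
    ~-irrefl : Irreflexive _≡_ _~_
    _~?_     : B.Decidable _~_

Connected : Graph n → Set
Connected G = ∀ u v → Star (Graph._~_ G) u v

-- C is a class of the reachability relation of R; for symmetric R, the vertex
-- set of a connected component.

IsComponent : Rel (Fin n) 0ℓ → Subset n → Set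
IsComponent R C = ∃ λ v → ∀ w → w ∈ C ⇔ Star R v w

HasAtLeastComponents : Rel (Fin n) 0ℓ → ℕ → Set
HasAtLeastComponents R k = ∃ λ (Cs : Vec (Subset _) k) → All (IsComponent R) Cs × Unique Cs

IsCycle : Rel (Fin n) 0ℓ → Vec (Fin n) (3 + m) → Set
IsCycle R c = Unique c × Linked R c × R (last c) (head c)

Acyclic : Rel (Fin n) 0ℓ → Set
Acyclic {n} R = ∀ m (c : Vec (Fin n) (3 + m)) → ¬ IsCycle R c

module _ (G : Graph n) where
  open Graph G

  -- Each undirected edge is listed exactly once, with its smaller endpoint first.

  edges : List (Fin n × Fin n)
  edges = filter (λ (u , v) → (u Fin.<? v) ×-dec (u ~? v)) (cartesianProduct (allFin n) (allFin n))

  Edge : Set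
  Edge = Fin (length edges)

  endpoints : Edge → Fin n × Fin n
  endpoints = List.lookup edges

  EdgeSet : Set
  EdgeSet = Subset (length edges)

  Joins : Edge → Rel (Fin n) 0ℓ
  Joins e u v = endpoints e ≡ (u , v) ⊎ endpoints e ≡ (v , u)

  AdjacentVia : EdgeSet → Rel (Fin n) 0ℓ
  AdjacentVia F u v = ∃ λ e → e ∈ F × Joins e u v

  -- Removing the edges F from G leaves exactly the edges in ∁ F, on all n vertices.

  SeparableBy : (k l : ℕ) → Set
  SeparableBy k l = ∃ λ (F : EdgeSet) →
    ∣ F ∣ ≡ l × HasAtLeastComponents (AdjacentVia (∁ F)) k

  record VertexEdgePair : Set where
    constructor ⟨_,_⟩
    field
      V : Subset n
      E : EdgeSet

  open VertexEdgePair public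

  -- Edges of G only, by typing; what remains is that their endpoints lie in V T.

  IsSubgraph : VertexEdgePair → Set
  IsSubgraph T = ∀ e → e ∈ E T → proj₁ (endpoints e) ∈ V T × proj₂ (endpoints e) ∈ V T

  IsTree : VertexEdgePair → Set
  IsTree T =
    Nonempty (V T) ×
    (∀ u v → u ∈ V T → v ∈ V T → Star (AdjacentVia (E T)) u v) ×
    Acyclic (AdjacentVia (E T))

  IsSTree : Subset n → VertexEdgePair → Set
  IsSTree S T = IsSubgraph T × IsTree T × S ⊆ V T

  InternallyDisjoint : Subset n → Rel VertexEdgePair 0ℓ
  InternallyDisjoint S T₁ T₂ = E T₁ ∩ E T₂ ≡ ⊥ × V T₁ ∩ V T₂ ≡ S

  HasDisjointSTrees : Subset n → ℕ → Set
  HasDisjointSTrees S m = ∃ λ (Ts : Vec VertexEdgePair m) →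
    All (IsSTree S) Ts × AllPairs (InternallyDisjoint S) Ts

private
  anyVec? : {A : Set} → (∀ {P : Pred A 0ℓ} → Decidable P → Dec (∃ P)) →
            {P : Pred (Vec A m) 0ℓ} → Decidable P → Dec (∃ P)
  anyVec? {zero}  search P? = map′ ([] ,_) (λ { ([] , p) → p }) (P? [])
  anyVec? {suc m} search P? =
    map′ (λ (x , xs , p) → (x ∷ xs) , p) (λ { ((x ∷ xs) , p) → x , xs , p })
         (search λ x → anyVec? search λ xs → P? (x ∷ xs))

  _≟ˢ_ : B.DecidableEquality (Subset n)
  _≟ˢ_ = Vec.≡-dec Bool._≟_

  _⇔?_ : {A B : Set} → Dec A → Dec B → Dec (A ⇔ B)
  A? ⇔? B? = map′ (λ (f , g) → mk⇔ f g) (λ e → Equivalence.to e , Equivalence.from e)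
                  ((A? →-dec B?) ×-dec (B? →-dec A?))

module _ {R : Rel (Fin n) 0ℓ} (R? : B.Decidable R) where

  private
    reachable : ∀ v → ∃ λ C → ∀ w → w ∈ C ⇔ Star R v w
    reachable v = grow ⁅ v ⁆ (x∈⁅x⁆ v) start (<-wellFounded _)
      where
      start : ∀ {w} → w ∈ ⁅ v ⁆ → Star R v w
      start w∈ with x∈⁅y⁆⇒x≡y v w∈
      ... | refl = ε

      closed : ∀ {C} → ¬ (∃ λ x → ∃ λ y → x ∈ C × ¬ (y ∈ C) × R x y) →
               ∀ {x w} → x ∈ C → Star R x w → w ∈ C
      closed _ x∈C ε = x∈C
      closed {C} stuck x∈C (_◅_ {j = y} Rxy rest) with y ∈? C
      ... | yes y∈C = closed stuck y∈C rest
      ... | no  y∉C = contradiction (_ , y , x∈C , y∉C , Rxy) stuck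

      grow : ∀ C → v ∈ C → (∀ {w} → w ∈ C → Star R v w) → Acc _<_ ∣ ∁ C ∣ →
             ∃ λ C → ∀ w → w ∈ C ⇔ Star R v w
      grow C v∈C sound (acc rec)
        with Fin.any? (λ x → Fin.any? (λ y → (x ∈? C) ×-dec ¬? (y ∈? C) ×-dec R? x y))
      ... | no stuck = C , λ w → mk⇔ sound (closed stuck v∈C)
      ... | yes (x , y , x∈C , y∉C , Rxy) =
        grow (C ∪ ⁅ y ⁆) (p⊆p∪q ⁅ y ⁆ v∈C) sound′
          (rec (p⊂q⇒∣p∣<∣q∣ (p⊂q⇒∁p⊃∁q (p⊆p∪q ⁅ y ⁆ , y , q⊆p∪q C ⁅ y ⁆ (x∈⁅x⁆ y) , y∉C))))
        where
        sound′ : ∀ {w} → w ∈ C ∪ ⁅ y ⁆ → Star R v w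
        sound′ w∈ with x∈p∪q⁻ C ⁅ y ⁆ w∈
        ... | inj₁ w∈C = sound w∈C
        ... | inj₂ w∈y with x∈⁅y⁆⇒x≡y y w∈y
        ...   | refl = sound x∈C ◅◅ (Rxy ◅ ε)

  star? : B.Decidable (Star R)
  star? v w with reachable v
  ... | C , C⇔ = map′ (Equivalence.to (C⇔ w)) (Equivalence.from (C⇔ w)) (w ∈? C)

  isComponent? : Decidable (IsComponent R)
  isComponent? C = Fin.any? λ v → Fin.all? λ w → (w ∈? C) ⇔? star? v w

  hasAtLeastComponents? : Decidable (HasAtLeastComponents R)
  hasAtLeastComponents? k = anyVec? anySubset? λ Cs →
    All.all? isComponent? Cs ×-dec allPairs? (λ C D → ¬? (C ≟ˢ D)) Cs

  isCycle? : Decidable (IsCycle {m = m} R)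
  isCycle? c =
    allPairs? (λ u v → ¬? (u Fin.≟ v)) c ×-dec linked? R? c ×-dec R? (last c) (head c)

  acyclic? : Dec (Acyclic R)
  acyclic? = map′ extend (λ noCycle {m} _ (c , cyc) → noCycle m c cyc)
                  (ℕ.allUpTo? (λ m → ¬? (anyVec? Fin.any? (isCycle? {m}))) n)
    where
    extend : (∀ {m} → m < n → ¬ (∃ (IsCycle {m = m} R))) → Acyclic R
    extend noCycle m c cyc@(unique , _) = noCycle m<n (c , cyc)
      where
      m<n : m < n
      m<n = ℕ.≤-trans (ℕ.m≤n+m (suc m) 2)
              (Fin.injective⇒≤ (Unique.lookup-injective unique _ _))

module _ (G : Graph n) where

  adjacentVia? : ∀ F → B.Decidable (AdjacentVia G F)
  adjacentVia? F u v = Fin.any? λ e →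
    (e ∈? F) ×-dec (eq? (endpoints G e) (u , v) ⊎-dec eq? (endpoints G e) (v , u))
    where
    eq? : B.DecidableEquality (Fin n × Fin n)
    eq? = Product.≡-dec Fin._≟_ Fin._≟_

  separableBy? : ∀ k → Decidable (SeparableBy G k)
  separableBy? k l = anySubset? λ F →
    (∣ F ∣ ℕ.≟ l) ×-dec hasAtLeastComponents? (adjacentVia? (∁ F)) k

  isSTree? : ∀ S → Decidable (IsSTree G S)
  isSTree? S ⟨ V , E ⟩ =
    (Fin.all? λ e → (e ∈? E) →-dec ((proj₁ (endpoints G e) ∈? V) ×-dec (proj₂ (endpoints G e) ∈? V)))
    ×-dec
    (nonempty? V ×-dec
     (Fin.all? λ u → Fin.all? λ v → (u ∈? V) →-dec ((v ∈? V) →-dec star? (adjacentVia? E) u v)) ×-dec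
     acyclic? (adjacentVia? E))
    ×-dec
    (S ⊆? V)

  hasDisjointSTrees? : ∀ S → Decidable (HasDisjointSTrees G S)
  hasDisjointSTrees? S m = anyVec? anyPair? λ Ts →
    All.all? (isSTree? S) Ts ×-dec
    allPairs? (λ T₁ T₂ → ((E T₁ ∩ E T₂) ≟ˢ ⊥) ×-dec ((V T₁ ∩ V T₂) ≟ˢ S)) Ts
    where
    anyPair? : {P : Pred (VertexEdgePair G) 0ℓ} → Decidable P → Dec (∃ P)
    anyPair? P? = map′ (λ (V , E , p) → ⟨ V , E ⟩ , p) (λ { (⟨ V , E ⟩ , p) → V , E , p })
                       (anySubset? λ V → anySubset? λ E → P? ⟨ V , E ⟩)

  private
    -- Removing all edges leaves n components.
    separable : k ≤ n → ∃ (SeparableBy G k)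
    separable {k} k≤n = ∣ all ∣ , all , refl , tabulate single , All.tabulate⁺ isComp , Unique.tabulate⁺ inj
      where
      all : EdgeSet G
      all = ⊤

      single : Fin k → Subset n
      single i = ⁅ inject≤ i k≤n ⁆

      stay : ∀ {u v} → Star (AdjacentVia G (∁ all)) u v → u ≡ v
      stay ε = refl
      stay ((e , e∈ , _) ◅ _) = contradiction ∈⊤ (x∈∁p⇒x∉p e∈)

      isComp : ∀ i → IsComponent (AdjacentVia G (∁ all)) (single i)
      isComp i = v , λ w → mk⇔ (to w) (from w)
        where
        v : Fin n
        v = inject≤ i k≤n
        to : ∀ w → w ∈ ⁅ v ⁆ → Star (AdjacentVia G (∁ all)) v w
        to w w∈ with x∈⁅y⁆⇒x≡y v w∈
        ... | refl = ε
        from : ∀ w → Star (AdjacentVia G (∁ all)) v w → w ∈ ⁅ v ⁆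
        from w p with stay p
        ... | refl = x∈⁅x⁆ v

      inj : ∀ {i j} → single i ≡ single j → i ≡ j
      inj {i} {j} eq = Fin.inject≤-injective k≤n k≤n i j
        (x∈⁅y⁆⇒x≡y _ (subst (inject≤ i k≤n ∈_) eq (x∈⁅x⁆ _)))

    leastSeparation : ∀ k → k ≤ n → ∃ (IsLeast (SeparableBy G k))
    leastSeparation k k≤n = least (separableBy? k) (separable k≤n)

  -- λₖ(G); the bound k ≤ n is what makes the minimum exist.

  edgeConnectivity : ∀ k → k ≤ n → ℕ
  edgeConnectivity k k≤n = proj₁ (leastSeparation k k≤n)

  edgeConnectivity-isLeast : ∀ k (k≤n : k ≤ n) →
    IsLeast (SeparableBy G k) (edgeConnectivity k k≤n)
  edgeConnectivity-isLeast k k≤n = proj₂ (leastSeparation k k≤n)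

private
  nonempty-of : (S : Subset n) → 1 ≤ ∣ S ∣ → Nonempty S
  nonempty-of (inside  ∷ S) _ = zero , Data.Vec.here
  nonempty-of (outside ∷ S) p with nonempty-of S p
  ... | x , x∈S = suc x , Data.Vec.there x∈S

  two-of : (S : Subset n) → 2 ≤ ∣ S ∣ → ∃ λ u → ∃ λ v → u ∈ S × v ∈ S × u ≢ v
  two-of (inside ∷ S) (s≤s p) with nonempty-of S p
  ... | x , x∈S = zero , suc x , Data.Vec.here , Data.Vec.there x∈S , λ ()
  two-of (outside ∷ S) p with two-of S p
  ... | u , v , u∈S , v∈S , u≢v =
    suc u , suc v , Data.Vec.there u∈S , Data.Vec.there v∈S , u≢v ∘ Fin.suc-injective

module _ (G : Graph n) where

  private
    hasEdge : ∀ S → 2 ≤ ∣ S ∣ → ∀ T → IsSTree G S T → Nonempty (E T)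
    hasEdge S 2≤S T (_ , (_ , conn , _) , S⊆V) with two-of S 2≤S
    ... | u , v , u∈S , v∈S , u≢v with conn u v (S⊆V u∈S) (S⊆V v∈S)
    ...   | ε = contradiction refl u≢v
    ...   | (e , e∈E , _) ◅ _ = e , e∈E

    chosenEdges : ∀ S → 2 ≤ ∣ S ∣ → (Ts : Vec (VertexEdgePair G) m) →
      All (IsSTree G S) Ts → AllPairs (InternallyDisjoint G S) Ts →
      ∃ λ (es : Vec (Edge G) m) → Unique es ×
        (∀ T → All (InternallyDisjoint G S T) Ts → All (_∉ E T) es)
    chosenEdges S 2≤S [] [] [] = [] , [] , λ _ _ → []
    chosenEdges S 2≤S (T ∷ Ts) (t ∷ ts) (d ∷ ds)
      with hasEdge S 2≤S T t | chosenEdges S 2≤S Ts ts ds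
    ... | e , e∈T | es , unique , avoid =
      e ∷ es ,
      All.map (λ e′∉T e≡e′ → e′∉T (subst (_∈ E T) e≡e′ e∈T)) (avoid T d) ∷ unique ,
      λ { U (dU ∷ dUs) →
          (λ e∈U → ∉⊥ (subst (e ∈_) (proj₁ dU) (x∈p∩q⁺ (e∈U , e∈T)))) ∷ avoid U dUs }

    treesBound : ∀ S → 2 ≤ ∣ S ∣ → ∀ m → HasDisjointSTrees G S m → m ≤ length (edges G)
    treesBound S 2≤S m (Ts , ts , ds) with chosenEdges S 2≤S Ts ts ds
    ... | es , unique , _ = Fin.injective⇒≤ (Unique.lookup-injective unique _ _)

    greatestPacking : ∀ S → 2 ≤ ∣ S ∣ → ∃ (IsGreatest (HasDisjointSTrees G S))
    greatestPacking S 2≤S =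
      greatest (hasDisjointSTrees? G S) ([] , [] , []) (length (edges G)) (treesBound S 2≤S)

  -- κ′_G(S); without 2 ≤ |S| a one-vertex tree could be repeated arbitrarily often.

  treeConnectivity : ∀ S → 2 ≤ ∣ S ∣ → ℕ
  treeConnectivity S 2≤S = proj₁ (greatestPacking S 2≤S)

  treeConnectivity-isGreatest : ∀ S (2≤S : 2 ≤ ∣ S ∣) →
    IsGreatest (HasDisjointSTrees G S) (treeConnectivity S 2≤S)
  treeConnectivity-isGreatest S 2≤S = proj₂ (greatestPacking S 2≤S)

  TreeConnectivityValue : (k m : ℕ) → Set
  TreeConnectivityValue k m = ∃ λ (S : Subset n) → Σ (2 ≤ ∣ S ∣) λ 2≤S →
    ∣ S ∣ ≡ k × treeConnectivity S 2≤S ≡ m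

  private
    subsetOfSize : ∀ {n} k → k ≤ n → ∃ λ (S : Subset n) → ∣ S ∣ ≡ k
    subsetOfSize {n} zero z≤n = ⊥ , ∣⊥∣≡0 n
    subsetOfSize (suc k) (s≤s k≤n) with subsetOfSize k k≤n
    ... | S , eq = inside ∷ S , cong suc eq

    treeConnectivityValue? : ∀ k → Decidable (TreeConnectivityValue k)
    treeConnectivityValue? k m = anySubset? λ S → value? S (2 ℕ.≤? ∣ S ∣)
      where
      value? : ∀ S → Dec (2 ≤ ∣ S ∣) →
               Dec (Σ (2 ≤ ∣ S ∣) λ 2≤S → ∣ S ∣ ≡ k × treeConnectivity S 2≤S ≡ m)
      value? S (no ¬2≤S) = no (¬2≤S ∘ proj₁)
      value? S (yes 2≤S) =
        map′ (2≤S ,_)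
             (λ (2≤S′ , eq , val) →
                eq , subst (λ p → treeConnectivity S p ≡ m) (ℕ.≤-irrelevant 2≤S′ 2≤S) val)
             ((∣ S ∣ ℕ.≟ k) ×-dec (treeConnectivity S 2≤S ℕ.≟ m))

    leastTreeConnectivity : ∀ k → 2 ≤ k → k ≤ n → ∃ (IsLeast (TreeConnectivityValue k))
    leastTreeConnectivity k 2≤k k≤n with subsetOfSize k k≤n
    ... | S , eq = least (treeConnectivityValue? k)
                         (_ , S , subst (2 ≤_) (sym eq) 2≤k , eq , refl)

  -- κ′ₖ(G)

  generalizedConnectivity : ∀ k → 2 ≤ k → k ≤ n → ℕ
  generalizedConnectivity k 2≤k k≤n = proj₁ (leastTreeConnectivity k 2≤k k≤n)

  generalizedConnectivity-isLeast : ∀ k (2≤k : 2 ≤ k) (k≤n : k ≤ n) →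
    IsLeast (TreeConnectivityValue k) (generalizedConnectivity k 2≤k k≤n)
  generalizedConnectivity-isLeast k 2≤k k≤n = proj₂ (leastTreeConnectivity k 2≤k k≤n)

{-# OPTIONS --safe #-}

-- Lower bound: choose one vertex in each of k components left by a minimum separating set F.
-- A tree through these k vertices uses at least k − 1 edges of F, because restoring an edge
-- merges at most two components; internally disjoint trees use disjoint parts of F.
--
-- Sharpness: in the star K₁,ₖ₋₁ the whole graph is an S-tree for every S, so κ′ₖ ≥ 1, and
-- removing all k − 1 edges leaves k components, so λₖ ≤ k − 1.
module Submission where

open import Defs
open import Data.Nat using (ℕ; _*_; _∸_; _≤_; _≥_)
open import Data.Product using (Σ; ∃; _×_)
open import Relation.Binary.PropositionalEquality using (_≡_)

import Data.Bool.Properties as Bool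
open import Data.Fin using (Fin; zero; suc; punchIn)
import Data.Fin as Fin
import Data.Fin.Properties as Fin
open import Data.Fin.Subset
  using (Subset; Side; inside; outside; _∈_; _∉_; _⊆_; _∩_; _∪_; _─_; _-_; ∁; ⁅_⁆; ⊤; ⊥; ∣_∣)
open import Data.Fin.Subset.Properties
open import Data.List using (List; length; allFin)
import Data.List as List
import Data.List.Membership.Propositional.Properties as List
import Data.List.Relation.Unary.All as ListAll
open import Data.List.Relation.Unary.AllPairs using (_∷_)
import Data.List.Relation.Unary.Any as Any
open import Data.List.Relation.Unary.Any.Properties using (lookup-index)
import Data.List.Relation.Unary.Unique.Propositional as ListUnique
import Data.List.Relation.Unary.Unique.Propositional.Properties as ListUnique
open import Data.Nat using (zero; suc; _+_; _<_; z≤n; s≤s)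
open import Data.Nat.Induction using (Acc; acc; <-wellFounded)
import Data.Nat.Properties as ℕ
open import Data.Product using (_,_; proj₁; proj₂)
open import Data.Sum using (inj₁; inj₂)
open import Data.Vec using (Vec; []; _∷_; last; lookup; tabulate; here; there)
import Data.Vec as Vec
import Data.Vec.Properties as Vec
open import Data.Vec.Relation.Unary.All as All using (All; []; _∷_)
import Data.Vec.Relation.Unary.All.Properties as All
open import Data.Vec.Relation.Unary.AllPairs using (AllPairs; []; _∷_)
open import Data.Vec.Relation.Unary.Linked using (_∷_)
import Data.Vec.Relation.Unary.Unique.Propositional.Properties as Unique
open import Function using (_∘_; _⇔_; mk⇔; Equivalence; Injective)
open import Relation.Binary using (Rel; Symmetric; DecidableEquality)
open import Relation.Binary.Construct.Closure.ReflexiveTransitive as Star using (Star; ε; _◅_; _◅◅_)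
open import Relation.Binary.PropositionalEquality
  using (refl; sym; trans; cong; cong₂; subst; _≢_)
open import Relation.Nullary using (yes; no; contradiction)
open import Relation.Unary using (Pred)
open import Level using (0ℓ)

private
  variable
    A : Set
    m n k : ℕ

-- Cardinalities of subsets and images; invariants along paths

∣p∩q∣+∣p─q∣≤∣p∣ : ∀ (p q : Subset n) → ∣ p ∩ q ∣ + ∣ p ─ q ∣ ≤ ∣ p ∣
∣p∩q∣+∣p─q∣≤∣p∣ []            []            = z≤n
∣p∩q∣+∣p─q∣≤∣p∣ (outside ∷ p) (outside ∷ q) = ∣p∩q∣+∣p─q∣≤∣p∣ p q
∣p∩q∣+∣p─q∣≤∣p∣ (outside ∷ p) (inside  ∷ q) = ∣p∩q∣+∣p─q∣≤∣p∣ p q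
∣p∩q∣+∣p─q∣≤∣p∣ (inside  ∷ p) (inside  ∷ q) = s≤s (∣p∩q∣+∣p─q∣≤∣p∣ p q)
∣p∩q∣+∣p─q∣≤∣p∣ (inside  ∷ p) (outside ∷ q) =
  subst (_≤ suc ∣ p ∣) (sym (ℕ.+-suc ∣ p ∩ q ∣ ∣ p ─ q ∣)) (s≤s (∣p∩q∣+∣p─q∣≤∣p∣ p q))

x∉p⇒∣⁅x⁆∪p∣≡1+∣p∣ : ∀ (x : Fin n) p → x ∉ p → ∣ ⁅ x ⁆ ∪ p ∣ ≡ suc ∣ p ∣
x∉p⇒∣⁅x⁆∪p∣≡1+∣p∣ zero    (inside  ∷ p) x∉p = contradiction here x∉p
x∉p⇒∣⁅x⁆∪p∣≡1+∣p∣ zero    (outside ∷ p) x∉p = cong (suc ∘ ∣_∣) (∪-identityˡ p)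
x∉p⇒∣⁅x⁆∪p∣≡1+∣p∣ (suc x) (inside  ∷ p) x∉p = cong suc (x∉p⇒∣⁅x⁆∪p∣≡1+∣p∣ x p (x∉p ∘ there))
x∉p⇒∣⁅x⁆∪p∣≡1+∣p∣ (suc x) (outside ∷ p) x∉p = x∉p⇒∣⁅x⁆∪p∣≡1+∣p∣ x p (x∉p ∘ there)

image : (Fin k → Fin n) → Subset n
image {zero}  r = ⊥
image {suc k} r = ⁅ r zero ⁆ ∪ image (r ∘ suc)

∈-image⁺ : ∀ (r : Fin k → Fin n) i → r i ∈ image r
∈-image⁺ r zero    = p⊆p∪q _ (x∈⁅x⁆ (r zero))
∈-image⁺ r (suc i) = q⊆p∪q ⁅ r zero ⁆ _ (∈-image⁺ (r ∘ suc) i)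

∈-image⁻ : ∀ (r : Fin k → Fin n) {x} → x ∈ image r → ∃ λ i → r i ≡ x
∈-image⁻ {zero}  r x∈ = contradiction x∈ ∉⊥
∈-image⁻ {suc k} r x∈ with x∈p∪q⁻ ⁅ r zero ⁆ _ x∈
... | inj₁ x∈r₀ = zero , sym (x∈⁅y⁆⇒x≡y _ x∈r₀)
... | inj₂ x∈im with ∈-image⁻ (r ∘ suc) x∈im
...   | i , eq = suc i , eq

∣image∣≡ : ∀ (r : Fin k → Fin n) → Injective _≡_ _≡_ r → ∣ image r ∣ ≡ k
∣image∣≡ {zero}  {n} r inj = ∣⊥∣≡0 n
∣image∣≡ {suc k}     r inj = trans
  (x∉p⇒∣⁅x⁆∪p∣≡1+∣p∣ (r zero) _ λ r₀∈ → Fin.0≢1+n (sym (inj (proj₂ (∈-image⁻ (r ∘ suc) r₀∈)))))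
  (cong suc (∣image∣≡ (r ∘ suc) (Fin.suc-injective ∘ inj)))

Unique⇒lookup-injective : {xs : List A} → ListUnique.Unique xs → Injective _≡_ _≡_ (List.lookup xs)
Unique⇒lookup-injective (x∉ ∷ _)      {zero}  {zero}  eq = refl
Unique⇒lookup-injective (x∉ ∷ _)      {zero}  {suc j} eq =
  contradiction eq (ListAll.lookup x∉ (List.∈-lookup j))
Unique⇒lookup-injective (x∉ ∷ _)      {suc i} {zero}  eq =
  contradiction (sym eq) (ListAll.lookup x∉ (List.∈-lookup i))
Unique⇒lookup-injective (_  ∷ unique) {suc i} {suc j} eq =
  cong suc (Unique⇒lookup-injective unique eq)

Star-invariant : {R : Rel (Fin n) 0ℓ} {c : Fin n → A} →
                 (∀ {x y} → R x y → c x ≡ c y) → ∀ {x y} → Star R x y → c x ≡ c y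
Star-invariant {c = c} inv = Star.fold (λ x y → c x ≡ c y) (trans ∘ inv) refl

-- Counting edges by contraction and over disjoint trees

module _ (_≟_ : DecidableEquality A) (α β : A) where

  identify : A → A
  identify x with x ≟ α
  ... | yes _ = β
  ... | no  _ = x

  identify-merges : identify α ≡ identify β
  identify-merges with α ≟ α | β ≟ α
  ... | no α≢α | _     = contradiction refl α≢α
  ... | yes _  | yes _ = refl
  ... | yes _  | no _  = refl

  identify-injective : ∀ {x y} → x ≢ α → y ≢ α → identify x ≡ identify y → x ≡ y
  identify-injective {x} {y} x≢α y≢α eq with x ≟ α | y ≟ α
  ... | yes x≡α | _       = contradiction x≡α x≢α
  ... | no _    | yes y≡α = contradiction y≡α y≢α
  ... | no _    | no _    = eq

module _ (G : Graph n) where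

  AdjacentVia-sym : ∀ F → Symmetric (AdjacentVia G F)
  AdjacentVia-sym F (e , e∈F , inj₁ eq) = e , e∈F , inj₂ eq
  AdjacentVia-sym F (e , e∈F , inj₂ eq) = e , e∈F , inj₁ eq

  Joins⇒≡ : ∀ (c : Fin n → A) e → c (proj₁ (endpoints G e)) ≡ c (proj₂ (endpoints G e)) →
            ∀ {x y} → Joins G e x y → c x ≡ c y
  Joins⇒≡ c e eq (inj₁ refl) = eq
  Joins⇒≡ c e eq (inj₂ refl) = sym eq

  module _ (_≟_ : DecidableEquality A) (E : EdgeSet G) where

    -- With `D` deleted from `E`, such a `c` is constant on every connected component. The
    -- edge-by-edge form lets a contraction be checked on single edges.
    ConstantOff : EdgeSet G → (Fin n → A) → Set
    ConstantOff D c = ∀ {e x y} → e ∈ E → e ∉ D → Joins G e x y → c x ≡ c y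

    private
      tail-label head-label : Edge G → (Fin n → A) → A
      tail-label e c = c (proj₁ (endpoints G e))
      head-label e c = c (proj₂ (endpoints G e))

    -- Contraction is done by relabelling: the graph and its vertices stay fixed, and only the
    -- labels at the two ends of `e` are merged.
    contract : Edge G → (Fin n → A) → Fin n → A
    contract e c = identify _≟_ (tail-label e c) (head-label e c) ∘ c

    -- The edge `e` is no longer exempt, but its end labels are now merged. Every other edge of `E`
    -- outside `D - e` was already outside `D`, and relabelling preserves equalities.
    contract-constantOff : ∀ D c e → ConstantOff D c → ConstantOff (D - e) (contract e c)
    contract-constantOff D c e const {e′} e′∈E e′∉D-e joins with e′ Fin.≟ e
    ... | yes refl = Joins⇒≡ (contract e c) e (identify-merges _≟_ _ _) joins
    ... | no e′≢e  = cong (identify _≟_ _ _)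
      (const e′∈E (λ e′∈D → e′∉D-e (x∈p∧x≢y⇒x∈p-y e′∈D e′≢e)) joins)

    -- Contracting an edge of D costs at most one of the vertices r i.
    connected⇒≤1+∣D∣ : ∀ D c → ConstantOff D c →
      (r : Fin k → Fin n) → (∀ i j → Star (AdjacentVia G E) (r i) (r j)) →
      Injective _≡_ _≡_ (c ∘ r) → k ≤ suc ∣ D ∣
    connected⇒≤1+∣D∣ D = go D (<-wellFounded ∣ D ∣)
      where
      go : ∀ {k} D → Acc _<_ ∣ D ∣ → ∀ c → ConstantOff D c →
        (r : Fin k → Fin n) → (∀ i j → Star (AdjacentVia G E) (r i) (r j)) →
        Injective _≡_ _≡_ (c ∘ r) → k ≤ suc ∣ D ∣
      go {zero}  D _         c const r conn inj = z≤n
      go {suc k} D (acc rec) c const r conn inj with nonempty? D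
      ... | no empty =
        -- With `D` empty all labels `c (r i)` agree, so at most one index exists. This is expressed
        -- by the constant map into `Fin 1` being injective.
        ℕ.≤-trans (Fin.injective⇒≤ {f = λ _ → zero {0}} (λ _ → inj (constant _ _))) (s≤s z≤n)
        where
        constant : ∀ i j → c (r i) ≡ c (r j)
        constant i j = Star-invariant
          (λ (e , e∈E , joins) → const e∈E (λ e∈D → empty (e , e∈D)) joins) (conn i j)
      ... | yes (e , e∈D) with Fin.any? (λ i → c (r i) ≟ tail-label e c)
      -- Contraction rewrites the tail label, so the one index carrying it is set aside by
      -- `punchIn i`. The other labels are unchanged, hence still distinct, and the removed edge
      -- pays for the lost index.
      ...   | yes (i , cri≡) = s≤s (ℕ.≤-trans
                (go (D - e) (rec (x∈p⇒∣p-x∣<∣p∣ e∈D)) (contract e c) (contract-constantOff D c e const)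
                    (r ∘ punchIn i) (λ _ _ → conn _ _)
                    (Fin.punchIn-injective i _ _ ∘ inj ∘ identify-injective _≟_ _ _ (avoid _) (avoid _)))
                (x∈p⇒∣p-x∣<∣p∣ e∈D))
        where
        avoid : ∀ j → c (r (punchIn i j)) ≢ tail-label e c
        avoid j eq = Fin.punchInᵢ≢i i j (inj (trans eq (sym cri≡)))
      ...   | no avoid = ℕ.≤-trans
                (go (D - e) (rec (x∈p⇒∣p-x∣<∣p∣ e∈D)) (contract e c) (contract-constantOff D c e const)
                    r conn
                    (inj ∘ identify-injective _≟_ _ _ (λ eq → avoid (_ , eq)) (λ eq → avoid (_ , eq))))
                (ℕ.m≤n⇒m≤1+n (x∈p⇒∣p-x∣<∣p∣ e∈D))

  -- Each tree is charged its share `F ∩ E T`. Since the trees are edge-disjoint, deleting the first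
  -- share leaves the others intact, and induction continues with `F ─ E T`.
  disjoint-trees-≤ : ∀ S t (F : EdgeSet G) (Ts : Vec (VertexEdgePair G) m) →
    All (λ T → t ≤ ∣ F ∩ E T ∣) Ts → AllPairs (InternallyDisjoint G S) Ts → m * t ≤ ∣ F ∣
  disjoint-trees-≤ S t F []       []         []       = z≤n
  disjoint-trees-≤ S t F (T ∷ Ts) (t≤ ∷ ts≤) (d ∷ ds) = ℕ.≤-trans
    (ℕ.+-mono-≤ t≤ (disjoint-trees-≤ S t (F ─ E T) Ts (remaining d ts≤) ds))
    (∣p∩q∣+∣p─q∣≤∣p∣ F (E T))
    where
    remaining : ∀ {m} {Us : Vec (VertexEdgePair G) m} → All (InternallyDisjoint G S T) Us →
      All (λ U → t ≤ ∣ F ∩ E U ∣) Us → All (λ U → t ≤ ∣ (F ─ E T) ∩ E U ∣) Us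
    remaining [] [] = []
    remaining (_∷_ {x = U} (disjoint , _) ds) (t≤ ∷ ts≤) =
      ℕ.≤-trans t≤ (p⊆q⇒∣p∣≤∣q∣ F∩U⊆) ∷ remaining ds ts≤
      where
      F∩U⊆ : F ∩ E U ⊆ (F ─ E T) ∩ E U
      F∩U⊆ e∈ with x∈p∩q⁻ F (E U) e∈
      ... | e∈F , e∈U = x∈p∩q⁺
        (x∈p∧x∉q⇒x∈p─q e∈F (λ e∈T → ∉⊥ (subst (_ ∈_) disjoint (x∈p∩q⁺ (e∈T , e∈U)))) , e∈U)

  -- Component labels and representatives

  module _ (F : EdgeSet G) (Cs : Vec (Subset n) k)
           (components : All (IsComponent (AdjacentVia G (∁ F))) Cs)
           (distinct : Injective _≡_ _≡_ (lookup Cs)) where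

    component-closed : ∀ {C} → IsComponent (AdjacentVia G (∁ F)) C →
      ∀ {x y} → AdjacentVia G (∁ F) x y → x ∈ C → y ∈ C
    component-closed (v , C⇔) xy x∈C =
      Equivalence.from (C⇔ _) (Equivalence.to (C⇔ _) x∈C ◅◅ (xy ◅ ε))

    -- One membership bit per listed component. `Cs` may omit components; vertices outside all
    -- listed ones share the all-`outside` label, which keeps the labelling total.
    label : Fin n → Vec Side k
    label x = Vec.map (λ C → lookup C x) Cs

    -- A component absorbs neighbours and adjacency is symmetric, so each bit agrees at both ends of
    -- a surviving edge.
    label-invariant : ∀ {x y} → AdjacentVia G (∁ F) x y → label x ≡ label y
    label-invariant {x} {y} xy = go Cs components
      where
      go : ∀ {k} (Cs : Vec (Subset n) k) → All (IsComponent (AdjacentVia G (∁ F))) Cs →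
        Vec.map (λ C → lookup C x) Cs ≡ Vec.map (λ C → lookup C y) Cs
      go []       []            = refl
      go (C ∷ Cs) (comp ∷ comps) = cong₂ _∷_ same (go Cs comps)
        where
        same : lookup C x ≡ lookup C y
        same with x ∈? C | y ∈? C
        ... | yes x∈C | _       = trans (Vec.[]=⇒lookup x∈C)
                                        (sym (Vec.[]=⇒lookup (component-closed comp xy x∈C)))
        ... | no x∉C  | yes y∈C =
          contradiction (component-closed comp (AdjacentVia-sym (∁ F) xy) y∈C) x∉C
        ... | no x∉C  | no y∉C  = trans (x∉p⇒lookup x∉C) (sym (x∉p⇒lookup y∉C))
          where
          x∉p⇒lookup : ∀ {z} → z ∉ C → lookup C z ≡ outside
          x∉p⇒lookup z∉C = Bool.¬-not (z∉C ∘ Vec.lookup⇒[]= _ C)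

    representative : Fin k → Fin n
    representative i = proj₁ (All.lookup⁺ components i)

    reachable⇔ : ∀ i w → w ∈ lookup Cs i ⇔ Star (AdjacentVia G (∁ F)) (representative i) w
    reachable⇔ i = proj₂ (All.lookup⁺ components i)

    -- Bit `i` is set at `representative i`, hence also at `representative j`. Whatever is reachable
    -- from the latter is then reachable from the former.
    label≡⇒⊆ : ∀ {i j} → label (representative i) ≡ label (representative j) →
               lookup Cs j ⊆ lookup Cs i
    label≡⇒⊆ {i} {j} eq {w} w∈Cⱼ =
      Equivalence.from (reachable⇔ i w)
        (Equivalence.to (reachable⇔ i _) rⱼ∈Cᵢ ◅◅ Equivalence.to (reachable⇔ j w) w∈Cⱼ)
      where
      bit : ∀ x → lookup (label x) i ≡ lookup (lookup Cs i) x
      bit x = Vec.lookup-map i (λ C → lookup C x) Cs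
      rⱼ∈Cᵢ : representative j ∈ lookup Cs i
      rⱼ∈Cᵢ = Vec.lookup⇒[]= _ _ (trans
        (trans (sym (bit _)) (trans (cong (λ l → lookup l i) (sym eq)) (bit _)))
        (Vec.[]=⇒lookup (Equivalence.from (reachable⇔ i _) ε)))

    label-representative-injective : Injective _≡_ _≡_ (label ∘ representative)
    label-representative-injective eq = distinct (⊆-antisym (label≡⇒⊆ (sym eq)) (label≡⇒⊆ eq))

    ∣image-representative∣ : ∣ image representative ∣ ≡ k
    ∣image-representative∣ =
      ∣image∣≡ representative (label-representative-injective ∘ cong label)

    -- Along `T` the label can change only across `F ∩ E T`. As `T` connects `k` vertices with
    -- distinct labels, `connected⇒≤1+∣D∣` applies with this intersection as `D`.
    STree-crosses : ∀ T → IsSTree G (image representative) T → k ∸ 1 ≤ ∣ F ∩ E T ∣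
    STree-crosses T (_ , (_ , conn , _) , S⊆V) = ℕ.∸-monoˡ-≤ 1
      (connected⇒≤1+∣D∣ (Vec.≡-dec Bool._≟_) (E T) (F ∩ E T) label
        (λ e∈T e∉ joins → label-invariant
          (_ , x∉p⇒x∈∁p (λ e∈F → e∉ (x∈p∩q⁺ (e∈F , e∈T))) , joins))
        representative
        (λ i j → conn _ _ (S⊆V (∈-image⁺ _ i)) (S⊆V (∈-image⁺ _ j)))
        label-representative-injective)

  -- Take `S` to be the set of component representatives, so that every `S`-tree pays `k ∸ 1` edges
  -- of `F`. A largest packing for `S` has at least `κ` trees, because `κ` is a lower bound over all
  -- sets of size `k`.
  bounded-by-separation : ∀ {l κ} → 2 ≤ k → SeparableBy G k l →
    (∀ j → TreeConnectivityValue G k j → κ ≤ j) → (k ∸ 1) * κ ≤ l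
  bounded-by-separation {k} {κ = κ} 2≤k (F , refl , Cs , components , unique) κ-min =
    subst (_≤ ∣ F ∣) (ℕ.*-comm κ (k ∸ 1)) (ℕ.≤-trans (ℕ.*-monoˡ-≤ (k ∸ 1) κ≤κS) packed)
    where
    distinct : Injective _≡_ _≡_ (lookup Cs)
    distinct = Unique.lookup-injective unique _ _
    S : Subset n
    S = image (representative F Cs components distinct)
    ∣S∣≡k : ∣ S ∣ ≡ k
    ∣S∣≡k = ∣image-representative∣ F Cs components distinct
    2≤S : 2 ≤ ∣ S ∣
    2≤S = subst (2 ≤_) (sym ∣S∣≡k) 2≤k
    κ≤κS : κ ≤ treeConnectivity G S 2≤S
    κ≤κS = κ-min _ (S , 2≤S , ∣S∣≡k , refl)
    packed : treeConnectivity G S 2≤S * (k ∸ 1) ≤ ∣ F ∣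
    packed =
      let Ts , trees , disjoint = proj₁ (treeConnectivity-isGreatest G S 2≤S) in
      disjoint-trees-≤ S (k ∸ 1) F Ts
        (All.map (λ {T} → STree-crosses F Cs components distinct T) trees) disjoint

  lower-bound : ∀ k (2≤k : 2 ≤ k) (k≤n : k ≤ n) →
    (k ∸ 1) * generalizedConnectivity G k 2≤k k≤n ≤ edgeConnectivity G k k≤n
  lower-bound k 2≤k k≤n = bounded-by-separation 2≤k
    (proj₁ (edgeConnectivity-isLeast G k k≤n)) (proj₂ (generalizedConnectivity-isLeast G k 2≤k k≤n))

  -- Edges and their endpoints

  edgeConnectivity≤∣edges∣ : ∀ n≤n → edgeConnectivity G n n≤n ≤ length (edges G)
  edgeConnectivity≤∣edges∣ n≤n = proj₂ (edgeConnectivity-isLeast G n n≤n) _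
    -- Every edge is deleted; the components are then the `n` singletons.
    (⊤ , ∣⊤∣≡n _ , tabulate ⁅_⁆ , All.tabulate⁺ singleton , Unique.tabulate⁺ ⁅⁆-injective)
    where
    stay : ∀ {u v} → Star (AdjacentVia G (∁ ⊤)) u v → u ≡ v
    stay = Star-invariant λ (_ , e∈ , _) → contradiction ∈⊤ (x∈∁p⇒x∉p e∈)
    singleton : ∀ v → IsComponent (AdjacentVia G (∁ ⊤)) ⁅ v ⁆
    singleton v = v , λ w → mk⇔
      (λ w∈ → subst (Star _ v) (sym (x∈⁅y⁆⇒x≡y v w∈)) ε)
      (λ vw → subst (_∈ ⁅ v ⁆) (stay vw) (x∈⁅x⁆ v))
    ⁅⁆-injective : ∀ {u v} → ⁅ u ⁆ ≡ ⁅ v ⁆ → u ≡ v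
    ⁅⁆-injective {u} {v} eq = x∈⁅y⁆⇒x≡y v (subst (u ∈_) eq (x∈⁅x⁆ u))

  edge-between : ∀ {u v} → u Fin.< v → Graph._~_ G u v → ∃ λ e → endpoints G e ≡ (u , v)
  edge-between {u} {v} u<v u~v = Any.index uv∈ , sym (lookup-index uv∈)
    where
    uv∈ = List.∈-filter⁺ _ (List.∈-cartesianProduct⁺ (List.∈-allFin u) (List.∈-allFin v)) (u<v , u~v)

  private
    ordered×adjacent : ∀ e → let u , v = endpoints G e in u Fin.< v × Graph._~_ G u v
    ordered×adjacent e = proj₂ (List.∈-filter⁻ _
      {xs = List.cartesianProduct (allFin n) (allFin n)} (List.∈-lookup e))

  endpoints-ordered : ∀ e → proj₁ (endpoints G e) Fin.< proj₂ (endpoints G e)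
  endpoints-ordered = proj₁ ∘ ordered×adjacent

  endpoints-adjacent : ∀ e → Graph._~_ G (proj₁ (endpoints G e)) (proj₂ (endpoints G e))
  endpoints-adjacent = proj₂ ∘ ordered×adjacent

  -- A product of duplicate-free lists is duplicate-free, and filtering preserves this.
  endpoints-injective : Injective _≡_ _≡_ (endpoints G)
  endpoints-injective = Unique⇒lookup-injective
    (ListUnique.filter⁺ _ (ListUnique.cartesianProduct⁺ (ListUnique.allFin⁺ n) (ListUnique.allFin⁺ n)))

-- The star with centre `zero` and `m` leaves

data StarAdjacent {m} : Rel (Fin (suc m)) 0ℓ where
  out : ∀ {i} → StarAdjacent zero (suc i)
  into : ∀ {i} → StarAdjacent (suc i) zero

star : ∀ m → Graph (suc m)
star m = record
  { _~_      = StarAdjacent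
  ; ~-sym    = λ { out → into ; into → out }
  ; ~-irrefl = λ { refl () }
  ; _~?_     = λ { zero    zero    → no λ ()
                 ; zero    (suc _) → yes out
                 ; (suc _) zero    → yes into
                 ; (suc _) (suc _) → no λ () }
  }

-- General in `R` to serve both for adjacency in the star and for adjacency through its full edge
-- set.
star-paths : {R : Rel (Fin (suc m)) 0ℓ} → Symmetric R → (∀ i → R zero (suc i)) → ∀ u v → Star R u v
star-paths {R = R} R-sym spoke u v = Star.reverse R-sym (from-centre u) ◅◅ from-centre v
  where
  from-centre : ∀ v → Star R zero v
  from-centre zero    = ε
  from-centre (suc i) = spoke i ◅ ε

star-connected : Connected (star m)
star-connected {m} = star-paths (Graph.~-sym (star m)) (λ _ → out)

-- An edge is determined by its leaf, and there are `m` leaves.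
∣edges-star∣≤ : ∀ m → length (edges (star m)) ≤ m
∣edges-star∣≤ m = Fin.injective⇒≤ leaf-injective
  where
  from-centre : ∀ e → ∃ λ i → endpoints (star m) e ≡ (zero , suc i)
  from-centre e with endpoints (star m) e | endpoints-ordered (star m) e | endpoints-adjacent (star m) e
  ... | .zero , .(suc _) | _  | out = _ , refl
  -- The smaller endpoint is listed first, so the centre cannot come second.
  ... | _     | ()  | into
  leaf-injective : Injective _≡_ _≡_ (proj₁ ∘ from-centre)
  leaf-injective {e} {e′} eq = endpoints-injective (star m)
    (trans (proj₂ (from-centre e)) (trans (cong (λ i → zero , suc i) eq) (sym (proj₂ (from-centre e′)))))

last-All : {P : Pred A 0ℓ} {xs : Vec A (suc m)} → All P xs → P (last xs)
last-All {m = zero}  (px ∷ [])       = px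
last-All {m = suc m} (px ∷ py ∷ pxs) = last-All (py ∷ pxs)

-- Of two consecutive vertices of a cycle exactly one is the centre; on three or more vertices
-- the centre would then be repeated.
star-acyclic : {R : Rel (Fin (suc m)) 0ℓ} → (∀ {u v} → R u v → StarAdjacent u v) → Acyclic R
star-acyclic R⇒ _ (x ∷ y ∷ z ∷ zs) ((_ ∷ x≢z ∷ _) ∷ y≢ ∷ _ , xy ∷ yz ∷ _ , closing)
  with R⇒ xy | R⇒ yz
... | out | into = x≢z refl
... | into | out with last (z ∷ zs) | last-All y≢ | R⇒ closing
...   | _ | 0≢last | out = 0≢last refl

star-whole-STree : ∀ S → IsSTree (star m) S ⟨ ⊤ , ⊤ ⟩
star-whole-STree {m} S =
  (λ _ _ → ∈⊤ , ∈⊤) ,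
  ((zero , ∈⊤) ,
   (λ u v _ _ → star-paths (AdjacentVia-sym (star m) ⊤) spoke u v) ,
   star-acyclic adjacent) ,
  (λ _ → ∈⊤)
  where
  spoke : ∀ i → AdjacentVia (star m) ⊤ zero (suc i)
  spoke i with edge-between (star m) {zero} {suc i} (s≤s z≤n) out
  ... | e , eq = e , ∈⊤ , inj₁ eq
  adjacent : ∀ {u v} → AdjacentVia (star m) ⊤ u v → StarAdjacent u v
  adjacent (e , _ , inj₁ eq) = subst (λ (u , v) → StarAdjacent u v) eq (endpoints-adjacent (star m) e)
  adjacent (e , _ , inj₂ eq) =
    Graph.~-sym (star m) (subst (λ (u , v) → StarAdjacent u v) eq (endpoints-adjacent (star m) e))

-- The whole star by itself is a packing of size one, with pairwise disjointness vacuous.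
star-1≤treeConnectivity : TreeConnectivityValue (star m) k n → 1 ≤ n
star-1≤treeConnectivity {m} (S , 2≤S , _ , refl) =
  proj₂ (treeConnectivity-isGreatest (star m) S 2≤S) 1
    (⟨ ⊤ , ⊤ ⟩ ∷ [] , star-whole-STree S ∷ [] , [] ∷ [])

-- Neither invariant is evaluated: the upper bound through the number of edges meets the general
-- lower bound, which forces equality.
star-sharp : ∀ m (2≤1+m : 2 ≤ suc m) →
  edgeConnectivity (star m) (suc m) ℕ.≤-refl ≡
    m * generalizedConnectivity (star m) (suc m) 2≤1+m ℕ.≤-refl
star-sharp m 2≤1+m = ℕ.≤-antisym
  (begin
    edgeConnectivity (star m) (suc m) ℕ.≤-refl ≤⟨ edgeConnectivity≤∣edges∣ (star m) ℕ.≤-refl ⟩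
    length (edges (star m))                    ≤⟨ ∣edges-star∣≤ m ⟩
    m                                          ≡⟨ ℕ.*-identityʳ m ⟨
    m * 1                                      ≤⟨ ℕ.*-monoʳ-≤ m 1≤κ ⟩
    m * generalizedConnectivity (star m) (suc m) 2≤1+m ℕ.≤-refl ∎)
  (lower-bound (star m) (suc m) 2≤1+m ℕ.≤-refl)
  where
  open ℕ.≤-Reasoning
  1≤κ : 1 ≤ generalizedConnectivity (star m) (suc m) 2≤1+m ℕ.≤-refl
  1≤κ = star-1≤treeConnectivity
    (proj₁ (generalizedConnectivity-isLeast (star m) (suc m) 2≤1+m ℕ.≤-refl))

corollary3p4 : (∀ {n : ℕ} (G : Graph n) → Connected G →
    ∀ (k : ℕ) (2≤k : 2 ≤ k) (k≤n : k ≤ n) →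
    edgeConnectivity G k k≤n ≥ (k ∸ 1) * generalizedConnectivity G k 2≤k k≤n)
    ×
    (∀ (k : ℕ) (2≤k : 2 ≤ k) →
    ∃ λ (n : ℕ) → Σ (Graph n) λ G → Connected G × Σ (k ≤ n) λ k≤n →
    edgeConnectivity G k k≤n ≡ (k ∸ 1) * generalizedConnectivity G k 2≤k k≤n)
corollary3p4 =
  (λ G _ → lower-bound G) ,
  -- The star has order exactly `k`, so `k ≤ n` is reflexivity and `k ∸ 1` reduces to `m`; `2≤k`
  -- excludes `k = 0`.
  λ { (suc m) 2≤k → suc m , star m , star-connected , ℕ.≤-refl , star-sharp m 2≤k }
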